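{- Let $n\ge 3$ (even or odd), $k\ge 3$ and $m\ge 2$ be integers. Then the strong metric dimension of $(C_n\square P_k)\square P_m$ is $2n$.
   Context: All graphs are finite and connected; $d(u,v)$ is the shortest-path distance. $C_n$ is the cycle on $n$ vertices and $P_k$ the path on $k$ vertices. The cartesian product $G\square H$ has vertex set $V(G)\times V(H)$, with $(g_1,h_1)$ adjacent to $(g_2,h_2)$ iff either $h_1=h_2$ and $g_1g_2\in E(G)$, or $g_1=g_2$ and $h_1h_2\in E(H)$. A set $Q\subseteq V(G)$ is a strong resolving set of $G$ if for any two distinct vertices $p,q$ of $G$ there is $s\in Q$ such that $p$ lies on some shortest $q$–$s$ path or $q$ lies on some shortest $p$–$s$ path. The strong metric dimension $\mathrm{sdim}(G)$ is the minimum size of a strong resolving set of $G$. -}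

module Defs where

open import Data.Fin.Base using (Fin; zero; suc; toℕ)
open import Data.Fin.Properties using (*↔×)
open import Data.List.Base using (List; []; _∷_; length)
open import Data.List.Membership.Propositional using (_∈_)
open import Data.List.Relation.Unary.Unique.Propositional using (Unique)
open import Data.Nat.Base using (ℕ; zero; suc; _*_; _≤_; _≥_; z≤n; s≤s)
open import Data.Nat.Properties using (1+n≢n)
open import Data.Product.Base using (_×_; _,_; ∃-syntax; Σ-syntax)
open import Data.Product.Function.NonDependent.Propositional using (_×-↔_)
open import Data.Sum.Base using (_⊎_; inj₁; inj₂; swap; map)
open import Function.Base using (_∘_)
open import Function.Bundles using (_↔_)
open import Function.Construct.Composition using (_↔-∘_)
open import Function.Construct.Identity using (↔-id)
open import Function.Construct.Symmetry using (↔-sym)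
open import Level using (0ℓ)
open import Relation.Binary.Construct.Closure.ReflexiveTransitive using (Star; ε; _◅_; _◅◅_; gmap; reverse)
open import Relation.Binary.Core using (Rel)
open import Relation.Binary.Definitions using (Symmetric)
open import Relation.Binary.PropositionalEquality.Core using (_≡_; _≢_; refl; sym; trans; cong)
open import Relation.Nullary.Negation.Core using (¬_)

-- Finite connected simple graphs.  An element of Star Adj u v is a walk
-- from u to v.
record Graph : Set₁ where
  field
    Vertex    : Set
    Adj       : Rel Vertex 0ℓ
    symmetric : Symmetric Adj
    loopless  : ∀ {v} → ¬ Adj v v
    order     : ℕ
    finite    : Vertex ↔ Fin order
    connected : ∀ u v → Star Adj u v

module _ (G : Graph) where
  open Graph G

  Walk : Rel Vertex 0ℓ
  Walk = Star Adj

  vertices : ∀ {u v} → Walk u v → List Vertex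
  vertices {u} ε       = u ∷ []
  vertices {u} (_ ◅ w) = u ∷ vertices w

  edgeCount : ∀ {u v} → Walk u v → ℕ
  edgeCount ε       = 0
  edgeCount (_ ◅ w) = suc (edgeCount w)

  IsPath : ∀ {u v} → Walk u v → Set
  IsPath w = Unique (vertices w)

  IsShortestPath : ∀ {u v} → Walk u v → Set
  IsShortestPath {u} {v} w =
    IsPath w × (∀ (w′ : Walk u v) → IsPath w′ → edgeCount w ≤ edgeCount w′)

  LiesOnShortestPath : (x u v : Vertex) → Set
  LiesOnShortestPath x u v =
    Σ[ w ∈ Walk u v ] IsShortestPath w × x ∈ vertices w

  IsStrongResolving : List Vertex → Set
  IsStrongResolving Q = ∀ p q → p ≢ q →
    ∃[ s ] s ∈ Q × (LiesOnShortestPath p q s ⊎ LiesOnShortestPath q p s)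

  -- sdim G = d, as a relation.  Sets of vertices are duplicate-free lists,
  -- so that length is cardinality.
  HasStrongMetricDimension : ℕ → Set
  HasStrongMetricDimension d =
    (∃[ Q ] Unique Q × IsStrongResolving Q × length Q ≡ d) ×
    (∀ Q → Unique Q → IsStrongResolving Q → d ≤ length Q)

PathAdj : ∀ k → Rel (Fin k) 0ℓ
PathAdj k i j = suc (toℕ i) ≡ toℕ j ⊎ suc (toℕ j) ≡ toℕ i

private
  fromZero : ∀ {k} (j : Fin (suc k)) → Star (PathAdj (suc k)) zero j
  fromZero         zero    = ε
  fromZero {suc k} (suc j) =
    inj₁ refl ◅ gmap suc (map (cong suc) (cong suc)) (fromZero j)

  pathConnected : ∀ {k} (i j : Fin k) → Star (PathAdj k) i j
  pathConnected {suc k} i j = reverse swap (fromZero i) ◅◅ fromZero j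

-- Vertices 0, …, k-1 in order.
path : ℕ → Graph
path k = record
  { Vertex    = Fin k
  ; Adj       = PathAdj k
  ; symmetric = swap
  ; loopless  = λ { (inj₁ e) → 1+n≢n e ; (inj₂ e) → 1+n≢n e }
  ; order     = k
  ; finite    = ↔-id (Fin k)
  ; connected = pathConnected
  }

-- The edges of the path 0, …, n-1 together with the edge joining n-1 and 0.
CycleAdj : ∀ n → Rel (Fin n) 0ℓ
CycleAdj n i j = PathAdj n i j ⊎
  ((suc (toℕ i) ≡ n × toℕ j ≡ 0) ⊎ (suc (toℕ j) ≡ n × toℕ i ≡ 0))

private
  cycleLoopless : ∀ {n} → n ≥ 3 → (i : Fin n) → ¬ CycleAdj n i i
  cycleLoopless _ i (inj₁ (inj₁ e)) = 1+n≢n e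
  cycleLoopless _ i (inj₁ (inj₂ e)) = 1+n≢n e
  cycleLoopless (s≤s (s≤s _)) i (inj₂ (inj₁ (e , z)))
    with () ← trans (sym e) (cong suc z)
  cycleLoopless (s≤s (s≤s _)) i (inj₂ (inj₂ (e , z)))
    with () ← trans (sym e) (cong suc z)

cycle : ∀ n → n ≥ 3 → Graph
cycle n n≥3 = record
  { Vertex    = Fin n
  ; Adj       = CycleAdj n
  ; symmetric = map swap swap
  ; loopless  = λ {i} → cycleLoopless n≥3 i
  ; order     = n
  ; finite    = ↔-id (Fin n)
  ; connected = λ i j → gmap (λ x → x) inj₁ (pathConnected i j)
  }

infixl 7 _□_

_□_ : Graph → Graph → Graph
G □ H = record
  { Vertex    = G.Vertex × H.Vertex
  ; Adj       = λ (g₁ , h₁) (g₂ , h₂) →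
                  (h₁ ≡ h₂ × G.Adj g₁ g₂) ⊎ (g₁ ≡ g₂ × H.Adj h₁ h₂)
  ; symmetric = map (λ (e , a) → sym e , G.symmetric a)
                    (λ (e , a) → sym e , H.symmetric a)
  ; loopless  = λ { (inj₁ (_ , a)) → G.loopless a
                  ; (inj₂ (_ , a)) → H.loopless a }
  ; order     = G.order * H.order
  ; finite    = ↔-sym *↔× ↔-∘ (G.finite ×-↔ H.finite)
  ; connected = λ (g₁ , h₁) (g₂ , h₂) →
                  gmap (_, h₁) (λ a → inj₁ (refl , a)) (G.connected g₁ g₂) ◅◅
                  gmap (g₂ ,_) (λ a → inj₂ (refl , a)) (H.connected h₁ h₂)
  }
  where
  module G = Graph G
  module H = Graph H

{-# OPTIONS --safe #-}
-- A shortest path from q to s through p has length d q p + d p s, so if p and q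
-- are at distance diam G, a vertex resolving them is p or q itself.  A strong
-- resolving set therefore meets every diametral pair, and the 2n pairs
--   (c , first , end) , (antipode of c , last , opposite end)
-- are disjoint.  Conversely the 2n vertices (c , first , end) resolve any p, q:
-- if p is not after q on the first path, p lies on a shortest path from q to
-- (c , first , end), where c is the coordinate of p on the cycle and the end is
-- the one reached from q by passing the last coordinate of p.
module Submission where

open import Data.Fin.Base using (Fin; zero; suc; toℕ; fromℕ; fromℕ<; combine; remQuot; opposite)
open import Data.Fin.Properties
  using (toℕ-injective; toℕ<n; toℕ≤pred[n]; toℕ-fromℕ; toℕ-fromℕ<; opposite-involutive; *↔×; remQuot-combine; injective⇒≤)
open import Data.List.Base using (List; length; lookup; tabulate)
open import Data.List.Membership.Propositional using (_∈_)
open import Data.List.Membership.Propositional.Properties using (∈-tabulate⁺)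
open import Data.List.Properties using (length-tabulate)
open import Data.List.Relation.Unary.All.Properties using (¬Any⇒All¬)
open import Data.List.Relation.Unary.AllPairs using ([]; _∷_)
open import Data.List.Relation.Unary.All using ([])
open import Data.List.Relation.Unary.Any using (here; there; index)
open import Data.List.Relation.Unary.Any.Properties using (lookup-index)
open import Data.List.Relation.Unary.Unique.Propositional.Properties using (tabulate⁺)
open import Data.Nat.Base
open import Data.Nat.Properties
open import Data.Product.Base using (_×_; _,_; proj₁; proj₂; ∃-syntax; Σ-syntax; map₂)
open import Data.Product.Properties using (,-injectiveˡ; ,-injectiveʳ)
open import Data.Sum.Base using (_⊎_; inj₁; inj₂; map; swap)
open import Function.Base using (_∘_; id)
open import Function.Bundles using (Injection)
open import Function.Definitions using (Injective)
open import Function.Properties.Inverse using (↔⇒↣)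
open import Relation.Binary.Construct.Closure.ReflexiveTransitive using (ε; _◅_; _◅◅_; gmap)
open import Relation.Binary.PropositionalEquality
open import Relation.Nullary using (¬_; yes; no; contradiction)
open import Defs

open Graph using (Vertex; Adj; symmetric)

-- Walks with their lengths.

WalkOfLength : (G : Graph) → Vertex G → Vertex G → ℕ → Set
WalkOfLength G u v l = Σ[ w ∈ Walk G u v ] edgeCount G w ≡ l

module _ (G : Graph) where

  edgeCount-◅◅ : ∀ {u v x} (w₁ : Walk G u v) (w₂ : Walk G v x) →
    edgeCount G (w₁ ◅◅ w₂) ≡ edgeCount G w₁ + edgeCount G w₂
  edgeCount-◅◅ ε        w₂ = refl
  edgeCount-◅◅ (_ ◅ w₁) w₂ = cong suc (edgeCount-◅◅ w₁ w₂)

  concat : ∀ {u v x l₁ l₂} → WalkOfLength G u v l₁ → WalkOfLength G v x l₂ →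
    WalkOfLength G u x (l₁ + l₂)
  concat (w₁ , refl) (w₂ , refl) = w₁ ◅◅ w₂ , edgeCount-◅◅ w₁ w₂

  edge : ∀ {u v} → Adj G u v → WalkOfLength G u v 1
  edge a = a ◅ ε , refl

  reverseWalk : ∀ {u v l} → WalkOfLength G u v l → WalkOfLength G v u l
  reverseWalk         (ε     , refl) = ε , refl
  reverseWalk {v = v} (a ◅ w , refl) =
    subst (WalkOfLength G v _) (+-comm _ 1)
      (concat (reverseWalk (w , refl)) (edge (symmetric G a)))

  split : ∀ {u v x} (w : Walk G u v) → x ∈ vertices G w →
    Σ[ w₁ ∈ Walk G u x ] Σ[ w₂ ∈ Walk G x v ]
      edgeCount G w₁ + edgeCount G w₂ ≡ edgeCount G w
  split ε       (here refl) = ε , ε , refl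
  split (a ◅ w) (here refl) = ε , a ◅ w , refl
  split (a ◅ w) (there x∈w) =
    let w₁ , w₂ , eq = split w x∈w in a ◅ w₁ , w₂ , cong suc eq

  start∈vertices : ∀ {u v} (w : Walk G u v) → u ∈ vertices G w
  start∈vertices ε       = here refl
  start∈vertices (_ ◅ _) = here refl

  join∈vertices : ∀ {u x v} (w₁ : Walk G u x) (w₂ : Walk G x v) →
    x ∈ vertices G (w₁ ◅◅ w₂)
  join∈vertices ε        w₂ = start∈vertices w₂
  join∈vertices (_ ◅ w₁) w₂ = there (join∈vertices w₁ w₂)

mapWalk : (G H : Graph) (f : Vertex G → Vertex H) →
  (hom : ∀ {u v} → Adj G u v → Adj H (f u) (f v)) →
  ∀ {u v l} → WalkOfLength G u v l → WalkOfLength H (f u) (f v) l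
mapWalk G H f hom (w , refl) = gmap f hom w , count w
  where
  count : ∀ {u v} (w : Walk G u v) → edgeCount H (gmap f hom w) ≡ edgeCount G w
  count ε       = refl
  count (_ ◅ w) = cong suc (count w)

-- Distance functions and shortest paths.

-- A certificate that `d` is the shortest-path distance: `d-refl` and `d-step` bound every walk from
-- below, and `geodesic` supplies a walk attaining the bound.
record IsDistance (G : Graph) (d : Vertex G → Vertex G → ℕ) : Set where
  field
    d-refl   : ∀ v → d v v ≡ 0
    d-step   : ∀ {u u′} v → Adj G u u′ → d u v ≤ suc (d u′ v)
    geodesic : ∀ u v → WalkOfLength G u v (d u v)

  d≤edgeCount : ∀ {u v} (w : Walk G u v) → d u v ≤ edgeCount G w
  d≤edgeCount ε       = ≤-reflexive (d-refl _)
  d≤edgeCount (a ◅ w) = ≤-trans (d-step _ a) (s≤s (d≤edgeCount w))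

  d-sym≤ : ∀ u v → d u v ≤ d v u
  d-sym≤ u v =
    let w , eq = reverseWalk G (geodesic v u) in ≤-trans (d≤edgeCount w) (≤-reflexive eq)

  d≡0⇒≡ : ∀ {u v} → d u v ≡ 0 → u ≡ v
  d≡0⇒≡ {u} {v} d≡0 with geodesic u v
  ... | ε     , _  = refl
  ... | _ ◅ _ , eq with () ← trans eq d≡0

  -- If the start recurred, the part of the walk after the recurrence would join the same endpoints
  -- with fewer than `d u v` edges.
  minimal⇒unique : ∀ {u v} (w : Walk G u v) → edgeCount G w ≤ d u v → IsPath G w
  minimal⇒unique         ε       _   = [] ∷ []
  minimal⇒unique {u} {v} (a ◅ w) w≤d = ¬Any⇒All¬ _ u∉w ∷ minimal⇒unique w w≤d′
    where
    w≤d′ = s≤s⁻¹ (≤-trans w≤d (d-step v a))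

    u∉w : ¬ u ∈ vertices G w
    u∉w u∈w = let w₁ , w₂ , eq = split G w u∈w in
      <⇒≱ w≤d (≤-trans (d≤edgeCount w₂) (≤-trans (m≤n+m _ _) (≤-reflexive eq)))

  between⇒lies : ∀ {u x v} → d u x + d x v ≡ d u v → LiesOnShortestPath G x u v
  between⇒lies {u} {x} {v} eq =
    let w₁ , eq₁ = geodesic u x
        w₂ , eq₂ = geodesic x v
        w≡d = trans (edgeCount-◅◅ G w₁ w₂) (trans (cong₂ _+_ eq₁ eq₂) eq)
    in w₁ ◅◅ w₂
     , (minimal⇒unique _ (≤-reflexive w≡d)
       , λ w′ _ → ≤-trans (≤-reflexive w≡d) (d≤edgeCount w′))
     , join∈vertices G w₁ w₂

  lies⇒between : ∀ {u x v} → LiesOnShortestPath G x u v → d u x + d x v ≤ d u v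
  lies⇒between {u} {x} {v} (w , (_ , w-min) , x∈w) =
    let w₁ , w₂ , eq = split G w x∈w
        g , g≡d = geodesic u v
    in begin
      d u x + d x v                    ≤⟨ +-mono-≤ (d≤edgeCount w₁) (d≤edgeCount w₂) ⟩
      edgeCount G w₁ + edgeCount G w₂  ≡⟨ eq ⟩
      -- Minimality of `w` is only among paths, so the geodesic `g` must first be seen to be a path.
      edgeCount G w                    ≤⟨ w-min g (minimal⇒unique g (≤-reflexive g≡d)) ⟩
      edgeCount G g                    ≡⟨ g≡d ⟩
      d u v                            ∎
    where open ≤-Reasoning

  -- Diametral pairs and the lower bound.

  module _ {D : ℕ} (d≤D : ∀ u v → d u v ≤ D) where

    beyondDiametral : ∀ {p q s} → D ≤ d q p → LiesOnShortestPath G p q s → p ≡ s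
    beyondDiametral {p} {q} {s} D≤d lies = d≡0⇒≡ (n≤0⇒n≡0 (+-cancelˡ-≤ D _ _ (begin
      D + d p s      ≤⟨ +-monoˡ-≤ _ D≤d ⟩
      d q p + d p s  ≤⟨ lies⇒between lies ⟩
      d q s          ≤⟨ d≤D q s ⟩
      D              ≡⟨ +-identityʳ D ⟨
      D + 0          ∎)))
      where open ≤-Reasoning

    resolving-hits : ∀ {Q p q} → IsStrongResolving G Q → p ≢ q → D ≤ d p q → p ∈ Q ⊎ q ∈ Q
    resolving-hits {Q} {p} {q} resolving p≢q D≤d with resolving p q p≢q
    ... | s , s∈Q , inj₁ lies =
      inj₁ (subst (_∈ Q) (sym (beyondDiametral (≤-trans D≤d (d-sym≤ p q)) lies)) s∈Q)
    ... | s , s∈Q , inj₂ lies =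
      inj₂ (subst (_∈ Q) (sym (beyondDiametral D≤d lies)) s∈Q)

    -- Pigeonhole: each pair is sent to the position in `Q` of one of its members, and disjoint
    -- pairs get different positions.
    disjointDiametralPairs⇒≤ : ∀ {l} (a b : Fin l → Vertex G) →
      Injective _≡_ _≡_ a → Injective _≡_ _≡_ b → (∀ i j → a i ≢ b j) →
      (∀ i → D ≤ d (a i) (b i)) → ∀ Q → IsStrongResolving G Q → l ≤ length Q
    disjointDiametralPairs⇒≤ {l} a b a-inj b-inj a≢b diametral Q resolving =
      injective⇒≤ position-injective
      where
      hit : ∀ i → a i ∈ Q ⊎ b i ∈ Q
      hit i = resolving-hits resolving (a≢b i i) (diametral i)

      position : Fin l → Fin (length Q)
      position i with hit i
      ... | inj₁ a∈Q = index a∈Q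
      ... | inj₂ b∈Q = index b∈Q

      -- Scrutinising `hit i` just as `position` does makes `position i` reduce in each branch, so
      -- injectivity can compare the looked-up vertices.
      chosen : ∀ i → (a i ≡ lookup Q (position i)) ⊎ (b i ≡ lookup Q (position i))
      chosen i with hit i
      ... | inj₁ a∈Q = inj₁ (lookup-index a∈Q)
      ... | inj₂ b∈Q = inj₂ (lookup-index b∈Q)

      position-injective : Injective _≡_ _≡_ position
      position-injective {i} {j} eq with chosen i | chosen j
      ... | inj₁ p | inj₁ q = a-inj (trans p (trans (cong (lookup Q) eq) (sym q)))
      ... | inj₂ p | inj₂ q = b-inj (trans p (trans (cong (lookup Q) eq) (sym q)))
      ... | inj₁ p | inj₂ q = contradiction (trans p (trans (cong (lookup Q) eq) (sym q))) (a≢b i j)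
      ... | inj₂ p | inj₁ q = contradiction (trans q (trans (cong (lookup Q) (sym eq)) (sym p))) (a≢b j i)

-- Products

module _ {G H : Graph} {d₁ : Vertex G → Vertex G → ℕ} {d₂ : Vertex H → Vertex H → ℕ} where

  infixl 6 _⊞_

  _⊞_ : Vertex (G □ H) → Vertex (G □ H) → ℕ
  (g , h) ⊞ (g′ , h′) = d₁ g g′ + d₂ h h′

  -- An edge changes one coordinate only, so the sum obeys `d-step`; a geodesic first moves in `G`,
  -- then in `H`.
  □-isDistance : IsDistance G d₁ → IsDistance H d₂ → IsDistance (G □ H) _⊞_
  □-isDistance D₁ D₂ = record
    { d-refl   = λ (g , h) → cong₂ _+_ (D₁.d-refl g) (D₂.d-refl h)
    ; d-step   = λ where
        (g , h) (inj₁ (refl , a)) → +-monoˡ-≤ _ (D₁.d-step g a)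
        {g₁ , _} (g , h) (inj₂ (refl , a)) →
          ≤-trans (+-monoʳ-≤ (d₁ g₁ g) (D₂.d-step h a)) (≤-reflexive (+-suc _ _))
    ; geodesic = λ (g , h) (g′ , h′) → concat (G □ H)
        (mapWalk G (G □ H) (_, h) (λ a → inj₁ (refl , a)) (D₁.geodesic g g′))
        (mapWalk H (G □ H) (g′ ,_) (λ a → inj₂ (refl , a)) (D₂.geodesic h h′))
    }
    where
    module D₁ = IsDistance D₁
    module D₂ = IsDistance D₂

-- Paths

pathDistance : ∀ {k} → Fin k → Fin k → ℕ
pathDistance i j = ∣ toℕ i - toℕ j ∣

pathWalk : ∀ {k} (i j : Fin k) → WalkOfLength (path k) i j (pathDistance i j)
pathWalk zero zero = ε , refl
pathWalk {suc (suc k)} zero (suc j) = concat (path _) (edge (path _) (inj₁ refl))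
  (mapWalk (path (suc k)) (path _) suc (map (cong suc) (cong suc)) (pathWalk zero j))
pathWalk {suc (suc k)} (suc i) zero = reverseWalk (path _) (concat (path _) (edge (path _) (inj₁ refl))
  (subst (WalkOfLength (path _) _ _) (∣-∣-identityˡ (toℕ i))
    (mapWalk (path (suc k)) (path _) suc (map (cong suc) (cong suc)) (pathWalk zero i))))
pathWalk {suc k} (suc i) (suc j) =
  mapWalk (path k) (path _) suc (map (cong suc) (cong suc)) (pathWalk i j)

∣n-1+n∣≡1 : ∀ n → ∣ n - suc n ∣ ≡ 1
∣n-1+n∣≡1 zero    = refl
∣n-1+n∣≡1 (suc n) = ∣n-1+n∣≡1 n

PathAdj⇒distance≡1 : ∀ {k} {i j : Fin k} → PathAdj k i j → pathDistance i j ≡ 1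
PathAdj⇒distance≡1 {i = i} (inj₁ e) rewrite sym e = ∣n-1+n∣≡1 (toℕ i)
PathAdj⇒distance≡1 {i = i} {j} (inj₂ e) rewrite sym e =
  trans (∣-∣-comm (suc (toℕ j)) (toℕ j)) (∣n-1+n∣≡1 (toℕ j))

pathDistance-step : ∀ {k} {i i′ : Fin k} j → PathAdj k i i′ →
  pathDistance i j ≤ suc (pathDistance i′ j)
pathDistance-step {i = i} {i′} j a =
  subst (λ l → pathDistance i j ≤ l + pathDistance i′ j) (PathAdj⇒distance≡1 a)
    (∣-∣-triangle (toℕ i) (toℕ i′) (toℕ j))

path-isDistance : ∀ k → IsDistance (path k) pathDistance
path-isDistance k = record
  { d-refl   = λ i → m≡n⇒∣m-n∣≡0 {toℕ i} refl
  ; d-step   = pathDistance-step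
  ; geodesic = pathWalk
  }

pathDistance≤ : ∀ {k} (i j : Fin (suc k)) → pathDistance i j ≤ k
pathDistance≤ i j =
  ≤-trans (∣m-n∣≤m⊔n (toℕ i) (toℕ j)) (⊔-lub (toℕ≤pred[n] i) (toℕ≤pred[n] j))

-- Indexing by `Fin 2` lets `opposite` exchange the two ends and `remQuot` enumerate them together
-- with the cycle.
end : ∀ {k} → Fin 2 → Fin (suc k)
end zero       = zero
end (suc zero) = fromℕ _

-- The implicit argument `suc k` gives the path at least two vertices; on a single vertex both ends
-- coincide.
end-injective : ∀ {k} → Injective _≡_ _≡_ (end {suc k})
end-injective {x = zero}     {zero}     _ = refl
end-injective {x = suc zero} {suc zero} _ = refl
end-injective {x = zero}     {suc zero} ()
end-injective {x = suc zero} {zero}     ()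

opposite-injective : ∀ {n} → Injective _≡_ _≡_ (opposite {n})
opposite-injective {x = i} {j} eq =
  trans (sym (opposite-involutive i)) (trans (cong opposite eq) (opposite-involutive j))

ends-diametral : ∀ {k} b → k ≤ pathDistance (end {k} b) (end (opposite b))
ends-diametral {k} zero       = ≤-reflexive (sym (toℕ-fromℕ k))
ends-diametral {k} (suc zero) =
  ≤-reflexive (sym (trans (∣-∣-identityʳ (toℕ (fromℕ k))) (toℕ-fromℕ k)))

between-≤ : ∀ {a b c} → a ≤ b → b ≤ c → ∣ a - b ∣ + ∣ b - c ∣ ≡ ∣ a - c ∣
between-≤ {a} {b} {c} a≤b b≤c = begin
  ∣ a - b ∣ + ∣ b - c ∣  ≡⟨ cong₂ _+_ (m≤n⇒∣m-n∣≡n∸m a≤b) (m≤n⇒∣m-n∣≡n∸m b≤c) ⟩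
  (b ∸ a) + (c ∸ b)      ≡⟨ +-comm (b ∸ a) (c ∸ b) ⟩
  (c ∸ b) + (b ∸ a)      ≡⟨ +-∸-assoc (c ∸ b) a≤b ⟨
  (c ∸ b + b) ∸ a        ≡⟨ cong (_∸ a) (m∸n+n≡m b≤c) ⟩
  c ∸ a                  ≡⟨ m≤n⇒∣m-n∣≡n∸m (≤-trans a≤b b≤c) ⟨
  ∣ a - c ∣              ∎
  where open ≡-Reasoning

between-first : ∀ {k} {i j : Fin (suc k)} → toℕ i ≤ toℕ j →
  pathDistance j i + pathDistance i zero ≡ pathDistance j (zero {k})
between-first {i = i} {j} i≤j = begin
  ∣ toℕ j - toℕ i ∣ + ∣ toℕ i - 0 ∣  ≡⟨ cong₂ _+_ (∣-∣-comm (toℕ j) (toℕ i)) (∣-∣-comm (toℕ i) 0) ⟩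
  ∣ toℕ i - toℕ j ∣ + ∣ 0 - toℕ i ∣  ≡⟨ +-comm ∣ toℕ i - toℕ j ∣ _ ⟩
  ∣ 0 - toℕ i ∣ + ∣ toℕ i - toℕ j ∣  ≡⟨ between-≤ z≤n i≤j ⟩
  ∣ 0 - toℕ j ∣                      ≡⟨ ∣-∣-comm 0 (toℕ j) ⟩
  ∣ toℕ j - 0 ∣                      ∎
  where open ≡-Reasoning

-- Walking from `j` to `i` and on in the same direction reaches an end.
between-end : ∀ {k} (i j : Fin (suc k)) →
  ∃[ b ] pathDistance j i + pathDistance i (end b) ≡ pathDistance j (end {k} b)
between-end {k} i j with ≤-total (toℕ i) (toℕ j)
... | inj₁ i≤j = zero , between-first i≤j
... | inj₂ j≤i = suc zero ,
  between-≤ j≤i (≤-trans (toℕ≤pred[n] i) (≤-reflexive (sym (toℕ-fromℕ k))))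

-- Cycles

-- The shorter of the two arcs; the first avoids the closing edge between the last vertex and 0, the
-- second uses it.
cycleDistance : ∀ {n} → Fin n → Fin n → ℕ
cycleDistance {n} i j = pathDistance i j ⊓ (n ∸ pathDistance i j)

∸-step : ∀ n {a a′} → a′ ≤ suc a → n ∸ a ≤ suc (n ∸ a′)
∸-step n {a} {a′} a′≤1+a = m≤n+o⇒m∸n≤o n a (begin
  n                   ≤⟨ m≤n+m∸n n a′ ⟩
  a′ + (n ∸ a′)       ≤⟨ +-monoˡ-≤ _ a′≤1+a ⟩
  suc a + (n ∸ a′)    ≡⟨ +-suc a (n ∸ a′) ⟨
  a + suc (n ∸ a′)    ∎)
  where open ≤-Reasoning

-- The effect of crossing the closing edge: the arcs to a fixed vertex change from `a` and `suc b`
-- to `suc a` and `b`.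
⊓-step : ∀ a b → a ⊓ suc b ≤ suc (b ⊓ suc a)
⊓-step a b = ⊓-glb (m⊓n≤n a (suc b)) (≤-trans (m⊓n≤m a (suc b)) (m≤n+m a 2))

cycleDistance-fromLast : ∀ {n} {i : Fin n} j → suc (toℕ i) ≡ n →
  cycleDistance i j ≡ (toℕ i ∸ toℕ j) ⊓ suc (toℕ j) × n ∸ toℕ j ≡ suc (toℕ i ∸ toℕ j)
cycleDistance-fromLast {n} {i} j 1+i≡n =
  cong₂ _⊓_ dist (trans (cong (n ∸_) dist) (trans (cong (_∸ (toℕ i ∸ toℕ j)) (sym 1+i≡n)) back))
  , trans (cong (_∸ toℕ j) (sym 1+i≡n)) (+-∸-assoc 1 j≤i)
  where
  j≤i : toℕ j ≤ toℕ i
  j≤i = s≤s⁻¹ (≤-trans (toℕ<n j) (≤-reflexive (sym 1+i≡n)))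

  dist : pathDistance i j ≡ toℕ i ∸ toℕ j
  dist = trans (∣-∣-comm (toℕ i) (toℕ j)) (m≤n⇒∣m-n∣≡n∸m j≤i)

  back : suc (toℕ i) ∸ (toℕ i ∸ toℕ j) ≡ suc (toℕ j)
  back = trans (+-∸-assoc 1 (m∸n≤m (toℕ i) (toℕ j))) (cong suc (m∸[m∸n]≡n j≤i))

cycleDistance-step : ∀ {n} {i i′ : Fin n} j → CycleAdj n i i′ →
  cycleDistance i j ≤ suc (cycleDistance i′ j)
cycleDistance-step {n} {i} {i′} j (inj₁ a) = ⊓-mono-≤ (pathDistance-step j a)
  -- The complementary arc is antitone in the distance, so the edge is taken in the other direction.
  (∸-step n (pathDistance-step j (swap a)))
cycleDistance-step {n} {i} {i′} j (inj₂ (inj₁ (1+i≡n , i′≡0)))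
  rewrite i′≡0 | proj₁ (cycleDistance-fromLast j 1+i≡n) | proj₂ (cycleDistance-fromLast j 1+i≡n)
  = ⊓-step (toℕ i ∸ toℕ j) (toℕ j)
cycleDistance-step {n} {i} {i′} j (inj₂ (inj₂ (1+i′≡n , i≡0)))
  rewrite i≡0 | proj₁ (cycleDistance-fromLast j 1+i′≡n) | proj₂ (cycleDistance-fromLast j 1+i′≡n)
  = ⊓-step (toℕ j) (toℕ i′ ∸ toℕ j)

pathWalkOnCycle : ∀ {n} (n≥3 : n ≥ 3) i j → WalkOfLength (cycle n n≥3) i j (pathDistance i j)
pathWalkOnCycle n≥3 i j = mapWalk (path _) (cycle _ n≥3) id inj₁ (pathWalk i j)

-- Go from `i` down to 0, across the closing edge to the last vertex, then down to `j`.
wrappingWalk-≤ : ∀ {n} (n≥3 : n ≥ 3) {i j} → toℕ i ≤ toℕ j →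
  WalkOfLength (cycle n n≥3) i j (n ∸ pathDistance i j)
wrappingWalk-≤ {suc n} n≥3 {i} {j} i≤j =
  subst (WalkOfLength C i j) total
    (concat C (pathWalkOnCycle n≥3 i zero)
      (concat C (edge C (inj₂ (inj₂ (cong suc (toℕ-fromℕ n) , refl))))
        (pathWalkOnCycle n≥3 (fromℕ n) j)))
  where
  open ≡-Reasoning
  C = cycle (suc n) n≥3

  j≤n : toℕ j ≤ n
  j≤n = toℕ≤pred[n] j

  total : pathDistance i (zero {n}) + suc (pathDistance (fromℕ n) j) ≡ suc n ∸ pathDistance i j
  total = begin
    ∣ toℕ i - 0 ∣ + suc ∣ toℕ (fromℕ n) - toℕ j ∣
      ≡⟨ cong₂ (λ a b → a + suc ∣ b - toℕ j ∣) (∣-∣-identityʳ (toℕ i)) (toℕ-fromℕ n) ⟩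
    toℕ i + suc ∣ n - toℕ j ∣
      ≡⟨ cong (λ a → toℕ i + suc a) (trans (∣-∣-comm n (toℕ j)) (m≤n⇒∣m-n∣≡n∸m j≤n)) ⟩
    toℕ i + suc (n ∸ toℕ j)
      ≡⟨ cong (toℕ i +_) (+-∸-assoc 1 j≤n) ⟨
    toℕ i + (suc n ∸ toℕ j)
      ≡⟨ +-∸-assoc (toℕ i) (m≤n⇒m≤1+n j≤n) ⟨
    (toℕ i + suc n) ∸ toℕ j
      -- Writing `toℕ j` as `toℕ i` plus the gap lets `toℕ i` cancel.
      ≡⟨ cong ((toℕ i + suc n) ∸_) (m+[n∸m]≡n i≤j) ⟨
    (toℕ i + suc n) ∸ (toℕ i + (toℕ j ∸ toℕ i))
      ≡⟨ [m+n]∸[m+o]≡n∸o (toℕ i) (suc n) _ ⟩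
    suc n ∸ (toℕ j ∸ toℕ i)
      ≡⟨ cong (suc n ∸_) (m≤n⇒∣m-n∣≡n∸m i≤j) ⟨
    suc n ∸ ∣ toℕ i - toℕ j ∣ ∎

module _ {n : ℕ} (n≥3 : n ≥ 3) where

  private
    C = cycle n n≥3

  wrappingWalk : ∀ i j → WalkOfLength C i j (n ∸ pathDistance i j)
  wrappingWalk i j with ≤-total (toℕ i) (toℕ j)
  ... | inj₁ i≤j = wrappingWalk-≤ n≥3 i≤j
  ... | inj₂ j≤i = subst (λ l → WalkOfLength C i j (n ∸ l)) (∣-∣-comm (toℕ j) (toℕ i))
                     (reverseWalk C (wrappingWalk-≤ n≥3 j≤i))

  cycle-isDistance : IsDistance C cycleDistance
  cycle-isDistance = record
    { d-refl   = λ i → cong (λ l → l ⊓ (n ∸ l)) (m≡n⇒∣m-n∣≡0 {toℕ i} refl)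
    ; d-step   = cycleDistance-step
    ; geodesic = geodesic
    }
    where
    geodesic : ∀ i j → WalkOfLength C i j (cycleDistance i j)
    geodesic i j with ⊓-sel (pathDistance i j) (n ∸ pathDistance i j)
    ... | inj₁ eq = subst (WalkOfLength C i j) (sym eq) (pathWalkOnCycle n≥3 i j)
    ... | inj₂ eq = subst (WalkOfLength C i j) (sym eq) (wrappingWalk i j)

-- Half-turns and antipodes on the cycle.

n∸⌈n/2⌉≡⌊n/2⌋ : ∀ n → n ∸ ⌈ n /2⌉ ≡ ⌊ n /2⌋
n∸⌈n/2⌉≡⌊n/2⌋ n =
  trans (cong (_∸ ⌈ n /2⌉) (sym (⌊n/2⌋+⌈n/2⌉≡n n))) (m+n∸n≡m ⌊ n /2⌋ ⌈ n /2⌉)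

n∸⌊n/2⌋≡⌈n/2⌉ : ∀ n → n ∸ ⌊ n /2⌋ ≡ ⌈ n /2⌉
n∸⌊n/2⌋≡⌈n/2⌉ n =
  trans (cong (_∸ ⌊ n /2⌋) (sym (⌊n/2⌋+⌈n/2⌉≡n n))) (m+n∸m≡n ⌊ n /2⌋ ⌈ n /2⌉)

m⊓[n∸m]≤⌊n/2⌋ : ∀ m n → m ⊓ (n ∸ m) ≤ ⌊ n /2⌋
m⊓[n∸m]≤⌊n/2⌋ m n with m ≤? ⌊ n /2⌋
... | yes m≤h = ≤-trans (m⊓n≤m m (n ∸ m)) m≤h
... | no  m≰h = begin
  m ⊓ (n ∸ m)   ≤⟨ m⊓n≤n m (n ∸ m) ⟩
  -- `⌈ n /2⌉` unfolds to `⌊ suc n /2⌋`, which is at most `suc ⌊ n /2⌋` and hence at most `m`.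
  n ∸ m         ≤⟨ ∸-monoʳ-≤ n (≤-trans (⌊n/2⌋-mono (n≤1+n (suc n))) (≰⇒> m≰h)) ⟩
  n ∸ ⌈ n /2⌉   ≡⟨ n∸⌈n/2⌉≡⌊n/2⌋ n ⟩
  ⌊ n /2⌋       ∎
  where open ≤-Reasoning

-- Rotation by `⌊ n /2⌋` modulo `n`, without and with wrapping. For odd `n` a vertex has two
-- farthest vertices; a fixed rotation picks one of them injectively.
Antipodal : ∀ {n} → Fin n → Fin n → Set
Antipodal {n} c c′ = toℕ c + ⌊ n /2⌋ ≡ toℕ c′ ⊎ toℕ c + ⌊ n /2⌋ ≡ toℕ c′ + n

∃-antipode : ∀ {n} (c : Fin n) → ∃[ c′ ] Antipodal c c′
∃-antipode {n} c with toℕ c + ⌊ n /2⌋ <? n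
... | yes c+h<n = fromℕ< c+h<n , inj₁ (sym (toℕ-fromℕ< c+h<n))
... | no  c+h≮n = fromℕ< wrapped<n ,
  inj₂ (trans (sym (m∸n+n≡m n≤c+h)) (cong (_+ n) (sym (toℕ-fromℕ< wrapped<n))))
  where
  n≤c+h = ≮⇒≥ c+h≮n

  -- The sum is below `n + n`, so subtracting `n` once is enough.
  wrapped<n : toℕ c + ⌊ n /2⌋ ∸ n < n
  wrapped<n = +-cancelʳ-< n _ n (subst (_< n + n) (sym (m∸n+n≡m n≤c+h))
    (+-mono-<-≤ (toℕ<n c) (⌊n/2⌋≤n n)))

antipode : ∀ {n} → Fin n → Fin n
antipode c = proj₁ (∃-antipode c)

-- Cancel the half-turn when both wrap or neither does. If exactly one wraps, its source exceeds the
-- other by `n`, which is out of range.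
antipodal-unique : ∀ {n} {c₁ c₂ c′ : Fin n} → Antipodal c₁ c′ → Antipodal c₂ c′ → c₁ ≡ c₂
antipodal-unique (inj₁ e₁) (inj₁ e₂) = toℕ-injective (+-cancelʳ-≡ _ _ _ (trans e₁ (sym e₂)))
antipodal-unique (inj₂ e₁) (inj₂ e₂) = toℕ-injective (+-cancelʳ-≡ _ _ _ (trans e₁ (sym e₂)))
antipodal-unique {n} {c₁} {c₂} (inj₁ e₁) (inj₂ e₂) = contradiction (toℕ<n c₂) (≤⇒≯ (wrap≥n e₁ e₂))
  where
  wrap≥n : ∀ {a b c h} → a + h ≡ c → b + h ≡ c + n → n ≤ b
  wrap≥n {a} {b} {c} {h} refl e = +-cancelʳ-≤ h n b (begin
    n + h        ≤⟨ m≤n+m (n + h) a ⟩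
    a + (n + h)  ≡⟨ cong (a +_) (+-comm n h) ⟩
    a + (h + n)  ≡⟨ +-assoc a h n ⟨
    a + h + n    ≡⟨ e ⟨
    b + h        ∎)
    where open ≤-Reasoning
antipodal-unique a₁@(inj₂ _) a₂@(inj₁ _) = sym (antipodal-unique a₂ a₁)

antipode-injective : ∀ {n} → Injective _≡_ _≡_ (antipode {n})
antipode-injective {n} {c₁} {c₂} eq =
  antipodal-unique (subst (Antipodal c₁) eq (proj₂ (∃-antipode c₁))) (proj₂ (∃-antipode c₂))

wrapped⇒≡+⌈n/2⌉ : ∀ n {c c′} → c + ⌊ n /2⌋ ≡ c′ + n → c ≡ c′ + ⌈ n /2⌉
wrapped⇒≡+⌈n/2⌉ n {c} {c′} e = +-cancelʳ-≡ ⌊ n /2⌋ _ _ (begin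
  c + ⌊ n /2⌋               ≡⟨ e ⟩
  c′ + n                    ≡⟨ cong (c′ +_) (⌊n/2⌋+⌈n/2⌉≡n n) ⟨
  c′ + (⌊ n /2⌋ + ⌈ n /2⌉)  ≡⟨ cong (c′ +_) (+-comm ⌊ n /2⌋ _) ⟩
  c′ + (⌈ n /2⌉ + ⌊ n /2⌋)  ≡⟨ +-assoc c′ _ _ ⟨
  c′ + ⌈ n /2⌉ + ⌊ n /2⌋    ∎)
  where open ≡-Reasoning

-- The direct arc is `⌊ n /2⌋` without wrapping and `⌈ n /2⌉` with it. In both cases the two arcs
-- are the two halves of `n`, and the smaller is the floor.
antipodal-diametral : ∀ {n} {c c′ : Fin n} → Antipodal c c′ → ⌊ n /2⌋ ≤ cycleDistance c c′
antipodal-diametral {n} {c} {c′} (inj₁ e)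
  rewrite sym e | ∣m-m+n∣≡n (toℕ c) ⌊ n /2⌋ | n∸⌊n/2⌋≡⌈n/2⌉ n
  = ⊓-glb ≤-refl (⌊n/2⌋≤⌈n/2⌉ n)
antipodal-diametral {n} {c} {c′} (inj₂ e)
  rewrite wrapped⇒≡+⌈n/2⌉ n e | ∣-∣-comm (toℕ c′ + ⌈ n /2⌉) (toℕ c′)
        | ∣m-m+n∣≡n (toℕ c′) ⌈ n /2⌉ | n∸⌈n/2⌉≡⌊n/2⌋ n
  = ⊓-glb (⌊n/2⌋≤⌈n/2⌉ n) ≤-refl

-- The product of a cycle and two paths

module _ (n k m : ℕ) (n≥3 : n ≥ 3) where

  private
    G = (cycle n n≥3 □ path (2+ k)) □ path (2+ m)

    dist = □-isDistance (□-isDistance (cycle-isDistance n≥3) (path-isDistance (2+ k)))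
             (path-isDistance (2+ m))

  open IsDistance dist

  corner antiCorner : Fin 2 × Fin n → Vertex G
  corner     (b , c) = (c , zero) , end b
  antiCorner (b , c) = (antipode c , fromℕ (suc k)) , end (opposite b)

  corner-injective : Injective _≡_ _≡_ corner
  corner-injective eq = cong₂ _,_ (end-injective (,-injectiveʳ eq)) (,-injectiveˡ (,-injectiveˡ eq))

  antiCorner-injective : Injective _≡_ _≡_ antiCorner
  antiCorner-injective eq = cong₂ _,_ (opposite-injective (end-injective (,-injectiveʳ eq)))
    (antipode-injective (,-injectiveˡ (,-injectiveˡ eq)))

  -- The coordinates on the first path are its first and last vertex, which differ as it has at
  -- least two vertices.
  corner≢antiCorner : ∀ x y → corner x ≢ antiCorner y
  corner≢antiCorner x y eq with () ← ,-injectiveʳ (,-injectiveˡ eq)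

  -- Enumerating the pairs by `Fin (2 * n)` makes the number of corners literally `2 * n`.
  remQuot-injective : Injective _≡_ _≡_ (remQuot {2} n)
  remQuot-injective = Injection.injective (↔⇒↣ (*↔× {2} {n}))

  corners : List (Vertex G)
  corners = tabulate (corner ∘ remQuot {2} n)

  corner∈corners : ∀ x → corner x ∈ corners
  corner∈corners x@(b , c) =
    subst (λ y → corner y ∈ corners) (remQuot-combine b c) (∈-tabulate⁺ (combine b c))

  -- Distances add over the factors, so betweenness is checked in each one. On the cycle it is
  -- trivial, as the corner shares the coordinate `c`.
  lies-towards-corner : ∀ {c c′ : Fin n} {i i′ : Fin (2+ k)} (j j′ : Fin (2+ m)) → toℕ i ≤ toℕ i′ →
    ∃[ s ] s ∈ corners × LiesOnShortestPath G ((c , i) , j) ((c′ , i′) , j′) s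
  lies-towards-corner {c} {c′} {i} {i′} j j′ i≤i′ =
    let b , j-between = between-end j j′
    in corner (b , c) , corner∈corners (b , c) , between⇒lies
         (trans (interchange₃ (cycleDistance c′ c) _ _ _ _ _)
           (cong₂ _+_
             (cong₂ _+_
               (trans (cong (cycleDistance c′ c +_) (IsDistance.d-refl (cycle-isDistance n≥3) c))
                 (+-identityʳ _))
               (between-first i≤i′))
             j-between))
    where
    open import Algebra.Properties.CommutativeSemigroup +-commutativeSemigroup using (interchange)
    interchange₃ : ∀ a b c a′ b′ c′ → (a + b + c) + (a′ + b′ + c′) ≡ (a + a′) + (b + b′) + (c + c′)
    interchange₃ a b c a′ b′ c′ =
      trans (interchange (a + b) c (a′ + b′) c′) (cong (_+ (c + c′)) (interchange a b a′ b′))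

  corners-resolving : IsStrongResolving G corners
  corners-resolving ((c , i) , j) ((c′ , i′) , j′) _ with ≤-total (toℕ i) (toℕ i′)
  ... | inj₁ i≤i′ = map₂ (map₂ inj₁) (lies-towards-corner j j′ i≤i′)
  ... | inj₂ i′≤i = map₂ (map₂ inj₂) (lies-towards-corner j′ j i′≤i)

  sdim-cycle□path□path : HasStrongMetricDimension G (2 * n)
  sdim-cycle□path□path =
    ( corners
    , tabulate⁺ (remQuot-injective ∘ corner-injective)
    , corners-resolving
    , length-tabulate (corner ∘ remQuot {2} n)) ,
    -- The bound `D` is `⌊ n /2⌋ + suc k + suc m`, read off from the coordinatewise bounds.
    λ Q _ → disjointDiametralPairs⇒≤
      (λ ((c , i) , j) ((c′ , i′) , j′) →
        +-mono-≤ (+-mono-≤ (m⊓[n∸m]≤⌊n/2⌋ (pathDistance c c′) n) (pathDistance≤ i i′))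
          (pathDistance≤ j j′))
      (corner ∘ remQuot {2} n) (antiCorner ∘ remQuot {2} n)
      (remQuot-injective ∘ corner-injective) (remQuot-injective ∘ antiCorner-injective)
      (λ i j → corner≢antiCorner (remQuot {2} n i) (remQuot {2} n j))
      (λ i → let b , c = remQuot {2} n i in
        -- The fixed index `zero` reflects that every corner starts at the first vertex of the first
        -- path; only the end on the second path varies with `b`.
        +-mono-≤ (+-mono-≤ (antipodal-diametral (proj₂ (∃-antipode c))) (ends-diametral {suc k} zero))
          (ends-diametral b))
      Q

theorem3p6 : (n k m : ℕ) (n≥3 : n ≥ 3) → k ≥ 3 → m ≥ 2 →
    HasStrongMetricDimension ((cycle n n≥3 □ path k) □ path m) (2 * n)
theorem3p6 n (2+ k) (2+ m) n≥3 (s≤s (s≤s _)) (s≤s (s≤s _)) = sdim-cycle□path□path n k m n≥3
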